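{- There is an absolute constant $c>0$ such that for every $n\ge 1$ and every Boolean function $f:\{0,1\}^n\to\{0,1\}$, $\mathsf{EC}(f)\le c\cdot\max\{1,\mathsf{DT}(f)\}^3$; that is, $\mathsf{EC}(f)\le O(\mathsf{DT}(f)^3)$.
   Context: A Boolean circuit $C$ over the basis $\mathcal{B}=\{\land_2,\lor_2,\lnot\}$ (AND and OR of fan-in 2, and NOT) is a directed acyclic graph with a root node of out-degree zero, input gates (in-degree zero) labeled by variables $x_1,\dots,x_n$, and non-input gates (including the root) labeled by functions in $\mathcal{B}$; gates may have arbitrary fan-out. For an input $a\in\{0,1\}^n$, $\mathsf{EC}(C,a)$ is the number of non-input gates of $C$ that output $1$ on $a$; $\mathsf{EC}(C)=\max_{a}\mathsf{EC}(C,a)$; and $\mathsf{EC}(f)$ is the minimum of $\mathsf{EC}(C)$ over all circuits $C$ over $\mathcal{B}$ computing $f$. There is no restriction on circuit size. A decision tree is a rooted binary tree whose internal nodes query variables and whose leaves are labeled $0$ or $1$; each input determines a root-to-leaf path, and the tree computes $f$ if for every input $a$ the leaf reached is labeled $f(a)$. Its depth is the length of the longest root-to-leaf path. $\mathsf{DT}(f)$ is the minimum depth of a decision tree computing $f$. -}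

module Defs where

open import Data.Bool using (Bool; true; false; _∧_; _∨_; not; if_then_else_)
open import Data.Empty using (⊥-elim)
open import Data.Fin using (Fin)
open import Data.Nat using (ℕ; zero; suc; _≤_; _⊔_)
open import Data.Nat.Induction using (<-rec)
open import Data.Nat.Properties using (≮⇒≥)
open import Data.Product using (∃; ∃-syntax; _×_; _,_)
open import Data.Sum using (_⊎_; [_,_]′)
open import Data.Vec using (Vec; []; _∷_; head; lookup; countᵇ)
open import Function using (id)
open import Relation.Binary.PropositionalEquality using (_≡_; refl)
open import Relation.Nullary using (¬_)

BoolFun : ℕ → Set
BoolFun n = Vec Bool n → Bool

maxOverInputs : ∀ {n} → (Vec Bool n → ℕ) → ℕ
maxOverInputs {zero}  g = g []
maxOverInputs {suc n} g =
  maxOverInputs (λ a → g (false ∷ a)) ⊔ maxOverInputs (λ a → g (true ∷ a))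

-- The minimum is a relation rather than a function, because there are
-- infinitely many circuits to minimise over.
IsMinOver : {A : Set} → (A → Set) → (A → ℕ) → ℕ → Set
IsMinOver {A} P μ m = (∃[ x ] P x × μ x ≡ m) × (∀ (x : A) → P x → m ≤ μ x)

-- As soon as P is inhabited the minimum exists, in the classical sense.
minExists : {A : Set} (P : A → Set) (μ : A → ℕ) →
            ∃ P → ¬ ¬ (∃[ m ] IsMinOver P μ m)
minExists {A} P μ (x₀ , p₀) none = noneAt (μ x₀) x₀ p₀ refl
  where
  noneAt : ∀ m (x : A) → P x → ¬ (μ x ≡ m)
  noneAt = <-rec (λ m → ∀ x → P x → ¬ (μ x ≡ m)) λ where
    m below x p refl → none
      (m , (x , p , refl) , λ y q → ≮⇒≥ (λ lt → below lt y q refl))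

-- Circuits are DAGs given with a topological order of their non-input gates.
-- In-neighbours are variables or strictly earlier gates; `inj₂ zero` is the
-- most recent of the k earlier gates.
Node : ℕ → ℕ → Set
Node n k = Fin n ⊎ Fin k

data Gate (n k : ℕ) : Set where
  and or : Node n k → Node n k → Gate n k
  neg    : Node n k → Gate n k

infixl 5 _▷_

data Gates (n : ℕ) : ℕ → Set where
  ε   : Gates n 0
  _▷_ : ∀ {k} → Gates n k → Gate n k → Gates n (suc k)

-- The root is the last gate: it is a non-input gate, and no gate can refer
-- to it, so its out-degree is zero.
record Circuit (n : ℕ) : Set where
  constructor circuit
  field
    {preceding} : ℕ
    gates       : Gates n (suc preceding)

open Circuit public

module _ {n : ℕ} (a : Vec Bool n) where

  nodeValue : ∀ {k} → Vec Bool k → Node n k → Bool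
  nodeValue vs = [ lookup a , lookup vs ]′

  gateValue : ∀ {k} → Vec Bool k → Gate n k → Bool
  gateValue vs (and u v) = nodeValue vs u ∧ nodeValue vs v
  gateValue vs (or u v)  = nodeValue vs u ∨ nodeValue vs v
  gateValue vs (neg u)   = not (nodeValue vs u)

  values : ∀ {k} → Gates n k → Vec Bool k
  values ε        = []
  values (gs ▷ g) = gateValue (values gs) g ∷ values gs

output : ∀ {n} → Circuit n → BoolFun n
output C a = head (values a (gates C))

ECAt : ∀ {n} → Circuit n → Vec Bool n → ℕ
ECAt C a = countᵇ id (values a (gates C))

ECCircuit : ∀ {n} → Circuit n → ℕ
ECCircuit C = maxOverInputs (ECAt C)

CircuitComputes : ∀ {n} → BoolFun n → Circuit n → Set
CircuitComputes f C = ∀ a → output C a ≡ f a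

IsEC : ∀ {n} → BoolFun n → ℕ → Set
IsEC f = IsMinOver (CircuitComputes f) ECCircuit

data DecisionTree (n : ℕ) : Set where
  leaf  : Bool → DecisionTree n
  query : Fin n → (on0 on1 : DecisionTree n) → DecisionTree n

leafReached : ∀ {n} → DecisionTree n → BoolFun n
leafReached (leaf b)        a = b
leafReached (query i t₀ t₁) a =
  if lookup a i then leafReached t₁ a else leafReached t₀ a

depth : ∀ {n} → DecisionTree n → ℕ
depth (leaf b)        = 0
depth (query i t₀ t₁) = suc (depth t₀ ⊔ depth t₁)

TreeComputes : ∀ {n} → BoolFun n → DecisionTree n → Set
TreeComputes f t = ∀ a → leafReached t a ≡ f a

IsDT : ∀ {n} → BoolFun n → ℕ → Set
IsDT f = IsMinOver (TreeComputes f) depth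

{-# OPTIONS --safe #-}

-- Along the path of an input, a decision tree of depth d reads bits q₀ , … , q_{d-1}.
-- Each q_j, and in the end the output, is computed from the earlier bits and
-- their negations: gates r ∧ q_i and r ∧ ¬ q_i push a reachability signal r
-- down the tree, where only the nodes on the path receive 1, and a tree of
-- OR gates collects the variable queried at depth j.  This costs O(j) energy,
-- however large the tree is.  Negating only the bits q_j, never the variables,
-- keeps the negations at one per level, so the total is O(d²).

module Submission where

open import Data.Bool using (Bool; true; false; _∧_; _∨_; not; if_then_else_)
open import Data.Bool.Properties using (∧-zeroʳ; ∧-identityʳ; ∨-inverseʳ; ∨-idem)
open import Data.Fin using (zero; suc)
open import Data.Nat using (ℕ; zero; suc; _+_; _*_; _^_; _≤_; _<_; _⊔_; z≤n; s≤s)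
open import Data.Nat.Properties
open import Data.Nat.Tactic.RingSolver using (solve-∀)
open import Data.Product using (∃-syntax; _×_; _,_; proj₁; proj₂)
open import Data.Sum using (inj₁; inj₂)
open import Data.Vec using (Vec; []; _∷_; lookup; countᵇ)
open import Function using (id; const; _∘_)
open import Relation.Binary.PropositionalEquality
  using (_≡_; refl; sym; trans; cong; cong₂)
open import Defs

maxOverInputs-lub : ∀ {n} (g : Vec Bool n → ℕ) {m} → (∀ a → g a ≤ m) → maxOverInputs g ≤ m
maxOverInputs-lub {zero}  g g≤m = g≤m []
maxOverInputs-lub {suc n} g g≤m =
  ⊔-lub (maxOverInputs-lub _ (g≤m ∘ (false ∷_))) (maxOverInputs-lub _ (g≤m ∘ (true ∷_)))

infix 8 _when_

_when_ : ℕ → Bool → ℕ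
m when b = if b then m else 0

when-≤ : ∀ m b → m when b ≤ m
when-≤ m false = z≤n
when-≤ m true  = ≤-refl

-- Beyond the end of the path the bit is the label of the leaf, so that the
-- output of the tree is one more path bit.
pathBit : ∀ {n} → DecisionTree n → ℕ → BoolFun n
pathBit (leaf b)        j       a = b
pathBit (query x t₀ t₁) zero    a = lookup a x
pathBit (query x t₀ t₁) (suc j) a = if lookup a x then pathBit t₁ j a else pathBit t₀ j a

pathBit-leafReached : ∀ {n} (t : DecisionTree n) {j} → depth t ≤ j →
                      ∀ a → pathBit t j a ≡ leafReached t a
pathBit-leafReached (leaf b)        _         a = refl
pathBit-leafReached (query x t₀ t₁) (s≤s d≤j) a =
  cong₂ (if lookup a x then_else_)
    (pathBit-leafReached t₁ (m⊔n≤o⇒n≤o (depth t₀) (depth t₁) d≤j) a)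
    (pathBit-leafReached t₀ (m⊔n≤o⇒m≤o (depth t₀) (depth t₁) d≤j) a)

module _ {n : ℕ} where

  energy : ∀ {k} → Gates n k → Vec Bool n → ℕ
  energy gs a = countᵇ id (values a gs)

  infix 4 _∋_

  -- A node may also be an input variable, so a variable is available in any list of gates at no
  -- energy.
  record _∋_ {k} (gs : Gates n k) (φ : BoolFun n) : Set where
    constructor _,_
    field
      node     : Node n k
      computes : ∀ a → nodeValue a (values a gs) node ≡ φ a

  ∋-resp : ∀ {k} {gs : Gates n k} {φ ψ} → (∀ a → φ a ≡ ψ a) → gs ∋ φ → gs ∋ ψ
  ∋-resp φ≗ψ (u , u≗φ) = u , λ a → trans (u≗φ a) (φ≗ψ a)

  ∋-▷ : ∀ {k} {gs : Gates n k} {g φ} → gs ∋ φ → gs ▷ g ∋ φ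
  ∋-▷ (inj₁ x , x≗φ) = inj₁ x , x≗φ
  ∋-▷ (inj₂ i , i≗φ) = inj₂ (suc i) , i≗φ

  -- The cost depends on the input: of two sibling subtrees only one fires on a given input, and a
  -- uniform bound would have to pay for both. `keeps` speaks of functions, so later constructions
  -- never handle shifted node indices.
  record Extension {k} (gs : Gates n k) (φ : BoolFun n) (cost : Vec Bool n → ℕ) : Set where
    field
      {size}   : ℕ
      extended : Gates n size
      keeps    : ∀ {ψ} → gs ∋ ψ → extended ∋ ψ
      gains    : extended ∋ φ
      energy≤  : ∀ a → energy extended a ≤ cost a + energy gs a

  open Extension

  relax : ∀ {k} {gs : Gates n k} {φ ψ c d} → (∀ a → φ a ≡ ψ a) → (∀ a → c a ≤ d a) →
          Extension gs φ c → Extension gs ψ d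
  relax φ≗ψ c≤d e = record
    { extended = extended e
    ; keeps    = keeps e
    ; gains    = ∋-resp φ≗ψ (gains e)
    ; energy≤  = λ a → ≤-trans (energy≤ e a) (+-monoˡ-≤ _ (c≤d a))
    }

  infixl 1 _>>=_

  _>>=_ : ∀ {k} {gs : Gates n k} {φ ψ c d} (e : Extension gs φ c) →
          Extension (extended e) ψ d → Extension gs ψ (λ a → d a + c a)
  _>>=_ {d = d} e e′ = record
    { extended = extended e′
    ; keeps    = keeps e′ ∘ keeps e
    ; gains    = gains e′
    ; energy≤  = λ a → ≤-trans (energy≤ e′ a)
                         (≤-trans (+-monoʳ-≤ (d a) (energy≤ e a))
                                  (≤-reflexive (sym (+-assoc (d a) _ _))))
    }

  energy-▷ : ∀ {k} (gs : Gates n k) (g : Gate n k) {b} a → gateValue a (values a gs) g ≡ b →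
             energy (gs ▷ g) a ≤ 1 when b + energy gs a
  energy-▷ gs g a refl with gateValue a (values a gs) g
  ... | false = ≤-refl
  ... | true  = ≤-refl

  already : ∀ {k} {gs : Gates n k} {φ} → gs ∋ φ → Extension gs φ (const 0)
  already {gs = gs} gs∋φ = record
    { extended = gs ; keeps = id ; gains = gs∋φ ; energy≤ = λ a → ≤-refl }

  addGate : ∀ {k} {gs : Gates n k} (g : Gate n k) {φ} →
            (∀ a → gateValue a (values a gs) g ≡ φ a) → Extension gs φ (λ a → 1 when φ a)
  addGate {gs = gs} g g≗φ = record
    { extended = gs ▷ g
    ; keeps    = ∋-▷
    ; gains    = inj₂ zero , g≗φ
    ; energy≤  = λ a → energy-▷ gs g a (g≗φ a)
    }

  addAnd : ∀ {k} {gs : Gates n k} {φ ψ} → gs ∋ φ → gs ∋ ψ →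
           Extension gs (λ a → φ a ∧ ψ a) (λ a → 1 when (φ a ∧ ψ a))
  addAnd (u , u≗φ) (v , v≗ψ) = addGate (and u v) λ a → cong₂ _∧_ (u≗φ a) (v≗ψ a)

  addOr : ∀ {k} {gs : Gates n k} {φ ψ} → gs ∋ φ → gs ∋ ψ →
          Extension gs (λ a → φ a ∨ ψ a) (λ a → 1 when (φ a ∨ ψ a))
  addOr (u , u≗φ) (v , v≗ψ) = addGate (or u v) λ a → cong₂ _∨_ (u≗φ a) (v≗ψ a)

  addNot : ∀ {k} {gs : Gates n k} {φ} → gs ∋ φ → Extension gs (not ∘ φ) (λ a → 1 when not (φ a))
  addNot (u , u≗φ) = addGate (neg u) λ a → cong not (u≗φ a)

  -- Both polarities are supplied, so that selecting a bit adds only AND and OR gates.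
  HasBits : ∀ {k} → Gates n k → (ℕ → BoolFun n) → ℕ → Set
  HasBits gs q j = ∀ {i} → i < j → gs ∋ q i × gs ∋ not ∘ q i

  -- The signal r says that the path reaches the subtree t; off the path
  -- (r = 0) no gate fires, and q need not describe t.
  select : ∀ (t : DecisionTree n) j (q : ℕ → BoolFun n) (r : BoolFun n) {k} (gs : Gates n k) →
           gs ∋ const false → gs ∋ r → HasBits gs q j →
           (∀ a → r a ≡ true → ∀ {i} → i < j → q i a ≡ pathBit t i a) →
           Extension gs (λ a → r a ∧ pathBit t j a) (λ a → suc (j + j) when r a)
  -- At a leaf no gate is added: the constant 0, or `r` itself, is already the wanted function.
  select (leaf false) j q r gs gs∋0 _ _ _ =
    relax (λ a → sym (∧-zeroʳ (r a))) (λ _ → z≤n) (already gs∋0)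
  select (leaf true) j q r gs _ gs∋r _ _ =
    relax (λ a → sym (∧-identityʳ (r a))) (λ _ → z≤n) (already gs∋r)
  select (query x t₀ t₁) zero q r gs _ gs∋r _ _ =
    relax (λ _ → refl) (λ a → cost≤ (r a) (lookup a x)) (addAnd gs∋r (inj₁ x , λ _ → refl))
    where
    cost≤ : ∀ r b → 1 when (r ∧ b) ≤ 1 when r
    cost≤ false b = z≤n
    cost≤ true  b = when-≤ 1 b
  select (query x t₀ t₁) (suc j) q r gs gs∋0 gs∋r bits onPath =
    relax value cost≤ (e₁ >>= e₂ >>= e₃ >>= e₄ >>= e₅)
    where
    r₁ r₀ : BoolFun n
    r₁ a = r a ∧ q 0 a
    r₀ a = r a ∧ not (q 0 a)

    -- If `r₁ a` holds, so do `r a` and `q 0 a`; by `onPath` at index 0 the variable `x` is 1, the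
    -- path enters `t₁`, and the remaining bits shift by one.
    onPath₁ : ∀ a → r₁ a ≡ true → ∀ {i} → i < j → q (suc i) a ≡ pathBit t₁ i a
    onPath₁ a r₁a i<j with r a in ra | q 0 a in qa
    ... | true | true = trans (onPath a ra (s≤s i<j))
      (cong (if_then _ else _) (trans (sym (onPath a ra (s≤s z≤n))) qa))

    onPath₀ : ∀ a → r₀ a ≡ true → ∀ {i} → i < j → q (suc i) a ≡ pathBit t₀ i a
    onPath₀ a r₀a i<j with r a in ra | q 0 a in qa
    ... | true | false = trans (onPath a ra (s≤s i<j))
      (cong (if_then _ else _) (trans (sym (onPath a ra (s≤s z≤n))) qa))

    keepsBits : ∀ {k′} {gs′ : Gates n k′} → (∀ {ψ} → gs ∋ ψ → gs′ ∋ ψ) → HasBits gs′ (q ∘ suc) j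
    keepsBits keep i<j = let p , p̄ = bits (s≤s i<j) in keep p , keep p̄

    e₁ = addAnd gs∋r (proj₁ (bits (s≤s z≤n)))
    e₂ = addAnd (keeps e₁ gs∋r) (keeps e₁ (proj₂ (bits (s≤s z≤n))))
    e₃ = select t₁ j (q ∘ suc) r₁ (extended e₂)
           (keeps e₂ (keeps e₁ gs∋0)) (keeps e₂ (gains e₁))
           (keepsBits (keeps e₂ ∘ keeps e₁)) onPath₁
    e₄ = select t₀ j (q ∘ suc) r₀ (extended e₃)
           (keeps e₃ (keeps e₂ (keeps e₁ gs∋0))) (keeps e₃ (gains e₂))
           (keepsBits (keeps e₃ ∘ keeps e₂ ∘ keeps e₁)) onPath₀
    e₅ = addOr (keeps e₄ (gains e₃)) (gains e₄)

    value : ∀ a → (r₁ a ∧ pathBit t₁ j a) ∨ (r₀ a ∧ pathBit t₀ j a)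
                  ≡ r a ∧ pathBit (query x t₀ t₁) (suc j) a
    value a with r a in ra
    ... | false = refl
    -- On the path `q 0` equals the queried variable, so the OR of the two branches is a
    -- multiplexer.
    ... | true rewrite onPath a ra {0} (s≤s z≤n) = mux (lookup a x) _ _
      where
      mux : ∀ b y z → (b ∧ y) ∨ (not b ∧ z) ≡ (if b then y else z)
      mux false y z = refl
      mux true  false z = refl
      mux true  true  z = refl

    eq : ∀ j → 1 + (suc (j + j) + 1) ≡ suc (suc j + suc j)
    eq = solve-∀

    -- At most one of `r₀`, `r₁` is true, so one recursive cost is paid, plus 1 for the signal and
    -- at most 1 for the OR: each level adds 2 and nothing doubles.
    cost≤ : ∀ a → 1 when ((r₁ a ∧ pathBit t₁ j a) ∨ (r₀ a ∧ pathBit t₀ j a))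
                  + (suc (j + j) when r₀ a + (suc (j + j) when r₁ a + (1 when r₀ a + 1 when r₁ a)))
                  ≤ suc (suc j + suc j) when r a
    cost≤ a with r a | q 0 a
    ... | false | _     = z≤n
    ... | true  | false = ≤-trans (+-monoˡ-≤ _ (when-≤ 1 _)) (≤-reflexive (eq j))
    ... | true  | true  = ≤-trans (+-monoˡ-≤ _ (when-≤ 1 _)) (≤-reflexive (eq j))

  record PathBits (t : DecisionTree n) (j : ℕ) : Set where
    field
      {size}  : ℕ
      gates   : Gates n size
      false∈  : gates ∋ const false
      true∈   : gates ∋ const true
      bits∈   : HasBits gates (pathBit t) j
      -- Bit i costs at most 2i+1 to select and 1 to negate, which sums to j(j+1); the constants
      -- account for the 2.
      energy≤ : ∀ a → energy gates a ≤ j * suc j + 2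

  nextPathBit : ∀ {t j} → PathBits t j → PathBits t (suc j)
  nextPathBit {t} {j} p = record
    { gates   = extended e₂
    ; false∈  = keep p.false∈
    ; true∈   = keep p.true∈
    ; bits∈   = bits
    ; energy≤ = λ a → ≤-trans (energy≤ e a)
        (≤-trans (+-mono-≤ (+-monoˡ-≤ _ (when-≤ 1 (not (pathBit t j a)))) (p.energy≤ a))
                 (≤-reflexive (eq j)))
    }
    where
    module p = PathBits p
    -- At the root the signal is constantly true and `q` is the path bit itself, so the invariant is
    -- `refl`.
    e₁ = select t j (pathBit t) (const true) p.gates p.false∈ p.true∈ p.bits∈ (λ _ _ _ → refl)
    e₂ = addNot (gains e₁)
    e  = e₁ >>= e₂

    keep : ∀ {ψ} → p.gates ∋ ψ → extended e₂ ∋ ψ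
    keep = keeps e₂ ∘ keeps e₁

    bits : HasBits (extended e₂) (pathBit t) (suc j)
    bits {i} (s≤s i≤j) with m≤n⇒m<n∨m≡n i≤j
    ... | inj₁ i<j  = let b , b̄ = p.bits∈ i<j in keep b , keep b̄
    ... | inj₂ refl = keeps e₂ (gains e₁) , gains e₂

    eq : ∀ j → 1 + suc (j + j) + (j * suc j + 2) ≡ suc j * suc (suc j) + 2
    eq = solve-∀

-- The variable x₀ provides the constants 1 = x₀ ∨ ¬ x₀ and 0 = ¬ 1.
pathBits : ∀ {n} (t : DecisionTree (suc n)) j → PathBits t j
pathBits t (suc j) = nextPathBit (pathBits t j)
pathBits t zero    = record
  { gates   = ε ▷ neg (inj₁ zero) ▷ or (inj₁ zero) (inj₂ zero) ▷ neg (inj₂ zero)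
  ; false∈  = inj₂ zero , λ a → cong not (∨-inverseʳ (lookup a zero))
  ; true∈   = inj₂ (suc zero) , λ a → ∨-inverseʳ (lookup a zero)
  ; bits∈   = λ ()
  ; energy≤ = λ { (false ∷ _) → ≤-refl ; (true ∷ _) → s≤s z≤n }
  }

treeCircuit : ∀ {n} (t : DecisionTree (suc n)) {d} → depth t ≤ d →
              ∃[ C ] CircuitComputes (leafReached t) C × ECCircuit C ≤ suc (suc d * suc (suc d) + 2)
treeCircuit t {d} t≤d =
  -- Every path has ended by index d, so bit d is the output; having it takes d+1 bits.
  let module p = PathBits (pathBits t (suc d))
      u , u≗bit = proj₁ (p.bits∈ ≤-refl)
      -- The root must be the last gate, while `u` may be any node; this gate copies it for energy
      -- at most 1.
      g = or u u
  in circuit (p.gates ▷ g)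
   , (λ a → trans (∨-idem _) (trans (u≗bit a) (pathBit-leafReached t t≤d a)))
   , maxOverInputs-lub _ λ a →
       ≤-trans (energy-▷ p.gates g a refl) (+-mono-≤ (when-≤ 1 _) (p.energy≤ a))

-- The constant 9 is the value of the left side at d = 1. After the shift to d+1 the difference of
-- the two sides has only nonnegative coefficients.
quadratic≤cubic : ∀ d → 0 < d → suc (suc d * suc (suc d) + 2) ≤ 9 * d ^ 3
quadratic≤cubic (suc d) _ =
  ≤-trans (m≤m+n _ (9 * (d * (d * d)) + 26 * (d * d) + 22 * d)) (≤-reflexive (eq d))
  where
  eq : ∀ d → suc (suc (suc d) * suc (suc (suc d)) + 2) + (9 * (d * (d * d)) + 26 * (d * d) + 22 * d)
             ≡ 9 * (suc d * (suc d * (suc d * 1)))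
  eq = solve-∀

theorem1p1 : ∃[ c ] (0 < c × (∀ (n : ℕ) → 1 ≤ n → (f : BoolFun n) (ec dt : ℕ) → IsEC f ec → IsDT f dt → ec ≤ c * (1 ⊔ dt) ^ 3))
theorem1p1 = 9 , s≤s z≤n , bound
  where
  bound : ∀ n → 1 ≤ n → (f : BoolFun n) (ec dt : ℕ) → IsEC f ec → IsDT f dt → ec ≤ 9 * (1 ⊔ dt) ^ 3
  bound (suc n) _ f ec dt (_ , ec≤) ((t , t≗f , refl) , _) =
    -- Raising the depth bound to at least 1 covers constant functions, where the quadratic bound is
    -- positive but the depth is 0.
    let C , C≗t , C≤ = treeCircuit t (m≤n⊔m 1 (depth t))
    in ≤-trans (ec≤ C (λ a → trans (C≗t a) (t≗f a)))
         (≤-trans C≤ (quadratic≤cubic (1 ⊔ depth t) (m≤m⊔n 1 (depth t))))
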